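{- Let $m\geq 2$ and $n\geq 3$ be integers and let $M$ be the adjacency matrix of the oriented Dutch windmill graph $D^m_n$, and let $I$ denote the identity matrix of order $m(n-1)+1$. Then: (1) $M^{2n-1}=mM^{n-1}$; (2) $M^{n-1}\neq 0$; (3) $M^{2n-2}\neq mM^{n-2}$; (4) $M^n\neq mI$; (5) $M^{n^2-1}=m^{n-1}M^{n-1}$.
   Context: For integers $m\geq 1$, $n\geq 3$, the oriented Dutch windmill graph $D^m_n$ is the directed graph with vertex set $V=\{1,2,\ldots,m(n-1)+1\}$ whose directed edges $(a,b)$ are exactly: $(1,(k-1)(n-1)+2)$ for $k\in\{1,\ldots,m\}$; $((k-1)(n-1)+i,(k-1)(n-1)+i+1)$ for $k\in\{1,\ldots,m\}$ and $i\in\{2,\ldots,n-1\}$; and $((k-1)(n-1)+n,1)$ for $k\in\{1,\ldots,m\}$. Its adjacency matrix $M=(a_{ij})$ is the real square matrix with $a_{ij}=1$ if $(i,j)$ is an edge and $a_{ij}=0$ otherwise. -}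

module Defs where

open import Algebra.Bundles using (CommutativeRing; Semiring)
open import Data.Bool.Base using (if_then_else_)
open import Data.Fin.Base using (Fin; toℕ)
import Data.Fin.Properties as Fin
open import Data.Nat.Base as ℕ using (ℕ; zero; suc; _∸_; _⊔_)
import Data.Nat.Properties as ℕ
open import Data.Product.Base using (∃-syntax; _×_; _,_)
open import Data.Rational.Base using (ℚ; 0ℚ; 1ℚ; ½; _+_; _*_; _-_; -_; _<_; _≤_; ∣_∣; 1/_; Positive; positive; nonNegative)
import Data.Rational.Properties as ℚ
open import Data.Rational.Solver using (module +-*-Solver)
open import Data.Sum.Base using (_⊎_)
open import Level using (0ℓ)
open import Relation.Binary.PropositionalEquality using (_≡_; refl; sym; trans; cong; subst)
open import Relation.Nullary.Decidable using (Dec; does; map′; _×-dec_; _⊎-dec_)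

Vanishing : (ℕ → ℕ → ℚ) → Set
Vanishing f = ∀ ε → 0ℚ < ε → ∃[ N ] (∀ i j → N ℕ.≤ i → N ℕ.≤ j → ∣ f i j ∣ < ε)

Cauchy : (ℕ → ℚ) → Set
Cauchy x = Vanishing λ i j → x i - x j

-- Real numbers form a setoid: two Cauchy sequences are equal (_≈ℝ_) when their
-- difference tends to zero.
record ℝ : Set where
  constructor mkℝ
  field
    seq    : ℕ → ℚ
    cauchy : Cauchy seq

open ℝ public

infix 4 _≈ℝ_

-- A record rather than a function, so that x and y can be inferred.
record _≈ℝ_ (x y : ℝ) : Set where
  constructor mk≈
  field
    null : ∀ ε → 0ℚ < ε → ∃[ N ] (∀ i → N ℕ.≤ i → ∣ seq x i - seq y i ∣ < ε)

open _≈ℝ_ public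

EventuallyBounded : (ℕ → ℚ) → Set
EventuallyBounded x = ∃[ B ] (Positive B × ∃[ N ] (∀ i → N ℕ.≤ i → ∣ x i ∣ ≤ B))

private
  half-pos : ∀ {ε} → 0ℚ < ε → 0ℚ < ½ * ε
  half-pos {ε} 0<ε = ℚ.positive⁻¹ (½ * ε) {{ℚ.pos*pos⇒pos ½ ε {{positive 0<ε}}}}

  halves : ∀ ε → ½ * ε + ½ * ε ≡ ε
  halves ε = trans (sym (ℚ.*-distribʳ-+ ε ½ ½)) (ℚ.*-identityˡ ε)

vanishing-cong : ∀ {f g} → (∀ i j → f i j ≡ g i j) → Vanishing f → Vanishing g
vanishing-cong f≡g v ε 0<ε with v ε 0<ε
... | N , h = N , λ i j p q → subst (λ r → ∣ r ∣ < ε) (f≡g i j) (h i j p q)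

vanishing-0 : Vanishing λ _ _ → 0ℚ
vanishing-0 ε 0<ε = 0 , λ _ _ _ _ → 0<ε

vanishing-+ : ∀ {f g} → Vanishing f → Vanishing g → Vanishing λ i j → f i j + g i j
vanishing-+ {f} {g} vf vg ε 0<ε with vf (½ * ε) (half-pos 0<ε) | vg (½ * ε) (half-pos 0<ε)
... | M , hf | N , hg = M ⊔ N , λ i j p q →
  subst (∣ f i j + g i j ∣ <_) (halves ε)
    (ℚ.≤-<-trans (ℚ.∣p+q∣≤∣p∣+∣q∣ (f i j) (g i j))
      (ℚ.+-mono-<
        (hf i j (ℕ.m⊔n≤o⇒m≤o M N p) (ℕ.m⊔n≤o⇒m≤o M N q))
        (hg i j (ℕ.m⊔n≤o⇒n≤o M N p) (ℕ.m⊔n≤o⇒n≤o M N q))))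

vanishing-neg : ∀ {f} → Vanishing f → Vanishing λ i j → - f i j
vanishing-neg {f} v ε 0<ε with v ε 0<ε
... | N , h = N , λ i j p q → subst (_< ε) (sym (ℚ.∣-p∣≡∣p∣ (f i j))) (h i j p q)

vanishing-swap : ∀ {f} → Vanishing f → Vanishing λ i j → f j i
vanishing-swap v ε 0<ε with v ε 0<ε
... | N , h = N , λ i j p q → h j i q p

vanishing-* : ∀ x {f} → EventuallyBounded x → Vanishing f → Vanishing λ i j → x i * f i j
vanishing-* x {f} (B , B>0 , M , bx) v ε 0<ε = helper (v δ δ>0)
  where
  instance
    posB = B>0
    nzB  = ℚ.pos⇒nonZero B
    posε = positive 0<ε
    pos1/B = ℚ.1/pos⇒pos B
    nnB  = ℚ.pos⇒nonNeg B
  δ : ℚ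
  δ = 1/ B * ε
  δ>0 : 0ℚ < δ
  δ>0 = ℚ.positive⁻¹ δ {{ℚ.pos*pos⇒pos (1/ B) ε}}
  Bδ≡ε : B * δ ≡ ε
  Bδ≡ε = trans (sym (ℚ.*-assoc B (1/ B) ε))
           (trans (cong (_* ε) (ℚ.*-inverseʳ B)) (ℚ.*-identityˡ ε))
  helper : ∃[ N ] (∀ i j → N ℕ.≤ i → N ℕ.≤ j → ∣ f i j ∣ < δ) →
           ∃[ N ] (∀ i j → N ℕ.≤ i → N ℕ.≤ j → ∣ x i * f i j ∣ < ε)
  helper (N , h) = M ⊔ N , λ i j p q →
    subst (_< ε) (sym (ℚ.∣p*q∣≡∣p∣*∣q∣ (x i) (f i j)))
      (ℚ.≤-<-trans
        (ℚ.*-monoʳ-≤-nonNeg ∣ f i j ∣ {{nonNegative (ℚ.0≤∣p∣ (f i j))}}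
          (bx i (ℕ.m⊔n≤o⇒m≤o M N p)))
        (subst (B * ∣ f i j ∣ <_) Bδ≡ε
          (ℚ.*-monoʳ-<-pos B (h i j (ℕ.m⊔n≤o⇒n≤o M N p) (ℕ.m⊔n≤o⇒n≤o M N q)))))

bounded : ∀ r → EventuallyBounded (seq r)
bounded (mkℝ x c) with c 1ℚ (ℚ.positive⁻¹ 1ℚ)
... | N , h = 1ℚ + ∣ x N ∣
            , ℚ.pos+nonNeg⇒pos 1ℚ ∣ x N ∣ {{nonNegative (ℚ.0≤∣p∣ (x N))}}
            , N , λ i p →
  subst (λ r → ∣ r ∣ ≤ 1ℚ + ∣ x N ∣) (eq (x i) (x N))
    (ℚ.≤-trans (ℚ.∣p+q∣≤∣p∣+∣q∣ (x i - x N) (x N))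
      (ℚ.+-monoˡ-≤ ∣ x N ∣ (ℚ.<⇒≤ (h i N p ℕ.≤-refl))))
  where
  open +-*-Solver
  eq : ∀ a b → (a - b) + b ≡ a
  eq = solve 2 (λ a b → (a :- b) :+ b := a) refl

infixl 6 _+ℝ_
infixl 7 _*ℝ_
infix  8 -ℝ_

_+ℝ_ : ℝ → ℝ → ℝ
x +ℝ y = mkℝ (λ i → seq x i + seq y i)
  (vanishing-cong (λ i j → eq (seq x i) (seq x j) (seq y i) (seq y j))
    (vanishing-+ (cauchy x) (cauchy y)))
  where
  open +-*-Solver
  eq : ∀ a b c d → (a - b) + (c - d) ≡ (a + c) - (b + d)
  eq = solve 4 (λ a b c d → (a :- b) :+ (c :- d) := (a :+ c) :- (b :+ d)) refl

-ℝ_ : ℝ → ℝ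
-ℝ x = mkℝ (λ i → - seq x i)
  (vanishing-cong (λ i j → ℚ.neg-distrib-+ (seq x i) (- seq x j)) (vanishing-neg (cauchy x)))

_*ℝ_ : ℝ → ℝ → ℝ
x *ℝ y = mkℝ (λ i → seq x i * seq y i)
  (vanishing-cong (λ i j → eq (seq x i) (seq x j) (seq y i) (seq y j))
    (vanishing-+
      (vanishing-* (seq x) (bounded x) (cauchy y))
      (vanishing-swap {λ j i → seq y j * (seq x i - seq x j)}
        (vanishing-* (seq y) (bounded y) (vanishing-swap (cauchy x))))))
  where
  open +-*-Solver
  eq : ∀ a b c d → a * (c - d) + d * (a - b) ≡ a * c - b * d
  eq = solve 4 (λ a b c d → a :* (c :- d) :+ d :* (a :- b) := a :* c :- b :* d) refl

fromℚ : ℚ → ℝ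
fromℚ q = mkℝ (λ _ → q) (vanishing-cong (λ _ _ → sym (ℚ.+-inverseʳ q)) vanishing-0)

0ℝ 1ℝ : ℝ
0ℝ = fromℚ 0ℚ
1ℝ = fromℚ 1ℚ

≈⇒vanishing : ∀ {x y} → x ≈ℝ y → Vanishing λ i _ → seq x i - seq y i
≈⇒vanishing (mk≈ e) ε 0<ε with e ε 0<ε
... | N , h = N , λ i _ p _ → h i p

vanishing⇒≈ : ∀ {x y} → Vanishing (λ i _ → seq x i - seq y i) → x ≈ℝ y
vanishing⇒≈ v = mk≈ λ ε 0<ε → let N , h = v ε 0<ε in N , λ i p → h i i p p

pointwise⇒≈ : ∀ {x y} → (∀ i → seq x i ≡ seq y i) → x ≈ℝ y
pointwise⇒≈ {x} {y} e = vanishing⇒≈ (vanishing-cong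
  (λ i _ → sym (trans (cong (_- seq y i) (e i)) (ℚ.+-inverseʳ (seq y i)))) vanishing-0)

private
  open +-*-Solver

  ≈-sym : ∀ {x y} → x ≈ℝ y → y ≈ℝ x
  ≈-sym {x} {y} e = vanishing⇒≈ (vanishing-cong (λ i _ → eq (seq x i) (seq y i))
    (vanishing-neg (≈⇒vanishing e)))
    where
    eq : ∀ a b → - (a - b) ≡ b - a
    eq = solve 2 (λ a b → :- (a :- b) := b :- a) refl

  ≈-trans : ∀ {x y z} → x ≈ℝ y → y ≈ℝ z → x ≈ℝ z
  ≈-trans {x} {y} {z} e f = vanishing⇒≈ (vanishing-cong
    (λ i _ → eq (seq x i) (seq y i) (seq z i))
    (vanishing-+ (≈⇒vanishing e) (≈⇒vanishing f)))
    where
    eq : ∀ a b c → (a - b) + (b - c) ≡ a - c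
    eq = solve 3 (λ a b c → (a :- b) :+ (b :- c) := a :- c) refl

  +ℝ-cong : ∀ {x y u v} → x ≈ℝ y → u ≈ℝ v → x +ℝ u ≈ℝ y +ℝ v
  +ℝ-cong {x} {y} {u} {v} e f = vanishing⇒≈ (vanishing-cong
    (λ i _ → eq (seq x i) (seq y i) (seq u i) (seq v i))
    (vanishing-+ (≈⇒vanishing e) (≈⇒vanishing f)))
    where
    eq : ∀ a b c d → (a - b) + (c - d) ≡ (a + c) - (b + d)
    eq = solve 4 (λ a b c d → (a :- b) :+ (c :- d) := (a :+ c) :- (b :+ d)) refl

  -ℝ-cong : ∀ {x y} → x ≈ℝ y → -ℝ x ≈ℝ -ℝ y
  -ℝ-cong {x} {y} e = vanishing⇒≈ (vanishing-cong
    (λ i _ → ℚ.neg-distrib-+ (seq x i) (- seq y i)) (vanishing-neg (≈⇒vanishing e)))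

  *ℝ-cong : ∀ {x y u v} → x ≈ℝ y → u ≈ℝ v → x *ℝ u ≈ℝ y *ℝ v
  *ℝ-cong {x} {y} {u} {v} e f = vanishing⇒≈ (vanishing-cong
    (λ i _ → eq (seq x i) (seq y i) (seq u i) (seq v i))
    (vanishing-+
      (vanishing-* (seq x) (bounded x) (≈⇒vanishing f))
      (vanishing-* (seq v) (bounded v) (≈⇒vanishing e))))
    where
    eq : ∀ a b c d → a * (c - d) + d * (a - b) ≡ a * c - b * d
    eq = solve 4 (λ a b c d → a :* (c :- d) :+ d :* (a :- b) := a :* c :- b :* d) refl

ℝ-commutativeRing : CommutativeRing 0ℓ 0ℓ
ℝ-commutativeRing = record
  { Carrier = ℝ ; _≈_ = _≈ℝ_ ; _+_ = _+ℝ_ ; _*_ = _*ℝ_ ; -_ = -ℝ_ ; 0# = 0ℝ ; 1# = 1ℝ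
  ; isCommutativeRing = record
    { isRing = record
      { +-isAbelianGroup = record
        { isGroup = record
          { isMonoid = record
            { isSemigroup = record
              { isMagma = record
                { isEquivalence = record
                  { refl = pointwise⇒≈ λ _ → refl ; sym = ≈-sym ; trans = ≈-trans }
                ; ∙-cong = +ℝ-cong }
              ; assoc = λ x y z → pointwise⇒≈ λ i → ℚ.+-assoc (seq x i) (seq y i) (seq z i) }
            ; identity = (λ x → pointwise⇒≈ λ i → ℚ.+-identityˡ (seq x i))
                       , (λ x → pointwise⇒≈ λ i → ℚ.+-identityʳ (seq x i)) }
          ; inverse = (λ x → pointwise⇒≈ λ i → ℚ.+-inverseˡ (seq x i))
                    , (λ x → pointwise⇒≈ λ i → ℚ.+-inverseʳ (seq x i))
          ; ⁻¹-cong = -ℝ-cong }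
        ; comm = λ x y → pointwise⇒≈ λ i → ℚ.+-comm (seq x i) (seq y i) }
      ; *-cong = *ℝ-cong
      ; *-assoc = λ x y z → pointwise⇒≈ λ i → ℚ.*-assoc (seq x i) (seq y i) (seq z i)
      ; *-identity = (λ x → pointwise⇒≈ λ i → ℚ.*-identityˡ (seq x i))
                   , (λ x → pointwise⇒≈ λ i → ℚ.*-identityʳ (seq x i))
      ; distrib = (λ x y z → pointwise⇒≈ λ i → ℚ.*-distribˡ-+ (seq x i) (seq y i) (seq z i))
                , (λ x y z → pointwise⇒≈ λ i → ℚ.*-distribʳ-+ (seq x i) (seq y i) (seq z i)) }
    ; *-comm = λ x y → pointwise⇒≈ λ i → ℚ.*-comm (seq x i) (seq y i) } }

module SquareMatrix {c ℓ} (R : Semiring c ℓ) where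
  open Semiring R using (_≈_; 0#; 1#) renaming (Carrier to A; _+_ to _+ᴿ_; _*_ to _*ᴿ_)
  open import Algebra.Definitions.RawMonoid (Semiring.+-rawMonoid R) using (sum) renaming (_×_ to _×ᴿ_)

  Matrix : ℕ → Set c
  Matrix d = Fin d → Fin d → A

  infix 4 _≈ᴹ_
  _≈ᴹ_ : ∀ {d} → Matrix d → Matrix d → Set ℓ
  X ≈ᴹ Y = ∀ i j → X i j ≈ Y i j

  0ᴹ : ∀ {d} → Matrix d
  0ᴹ _ _ = 0#

  Iᴹ : ∀ {d} → Matrix d
  Iᴹ i j = if does (i Fin.≟ j) then 1# else 0#

  infixl 7 _*ᴹ_
  _*ᴹ_ : ∀ {d} → Matrix d → Matrix d → Matrix d
  (X *ᴹ Y) i j = sum λ k → X i k *ᴿ Y k j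

  infixr 8 _^ᴹ_
  _^ᴹ_ : ∀ {d} → Matrix d → ℕ → Matrix d
  X ^ᴹ zero  = Iᴹ
  X ^ᴹ suc k = X *ᴹ X ^ᴹ k

  infixr 7 _·ᴹ_
  _·ᴹ_ : ∀ {d} → A → Matrix d → Matrix d
  (r ·ᴹ X) i j = r *ᴿ X i j

  fromℕ : ℕ → A
  fromℕ k = k ×ᴿ 1#

open SquareMatrix (CommutativeRing.semiring ℝ-commutativeRing) public

infix 4 _∈[_,_]
_∈[_,_] : ℕ → ℕ → ℕ → Set
k ∈[ a , b ] = a ℕ.≤ k × k ℕ.≤ b

-- The edges of the oriented Dutch windmill graph.  Vertices are referred to by
-- their labels 1, …, m(n-1)+1.  All occurrences of truncated subtraction are
-- exact in the intended range n ≥ 3, k ≥ 1.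
Edge : (m n : ℕ) → ℕ → ℕ → Set
Edge m n a b =
    (∃[ k ] (k ∈[ 1 , m ] × a ≡ 1 × b ≡ (k ∸ 1) ℕ.* (n ∸ 1) ℕ.+ 2))
  ⊎ (∃[ k ] (k ∈[ 1 , m ] × ∃[ i ] (i ∈[ 2 , n ∸ 1 ]
      × a ≡ (k ∸ 1) ℕ.* (n ∸ 1) ℕ.+ i
      × b ≡ (k ∸ 1) ℕ.* (n ∸ 1) ℕ.+ i ℕ.+ 1)))
  ⊎ (∃[ k ] (k ∈[ 1 , m ] × a ≡ (k ∸ 1) ℕ.* (n ∸ 1) ℕ.+ n × b ≡ 1))

any∈[]? : ∀ {P : ℕ → Set} → (∀ k → Dec (P k)) → ∀ a b → Dec (∃[ k ] (k ∈[ a , b ] × P k))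
any∈[]? P? a b = map′
  (λ (k , k<1+b , a≤k , p) → k , (a≤k , ℕ.≤-pred k<1+b) , p)
  (λ (k , (a≤k , k≤b) , p) → k , ℕ.s≤s k≤b , a≤k , p)
  (ℕ.anyUpTo? (λ k → (a ℕ.≤? k) ×-dec P? k) (suc b))

edge? : ∀ m n a b → Dec (Edge m n a b)
edge? m n a b =
        any∈[]? (λ k → (a ℕ.≟ _) ×-dec (b ℕ.≟ _)) 1 m
  ⊎-dec any∈[]? (λ k → any∈[]? (λ i → (a ℕ.≟ _) ×-dec (b ℕ.≟ _)) 2 (n ∸ 1)) 1 m
  ⊎-dec any∈[]? (λ k → (a ℕ.≟ _) ×-dec (b ℕ.≟ _)) 1 m

order : ℕ → ℕ → ℕ
order m n = m ℕ.* (n ∸ 1) ℕ.+ 1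

label : ∀ {d} → Fin d → ℕ
label v = suc (toℕ v)

adjacency : ∀ m n → Matrix (order m n)
adjacency m n u v = if does (edge? m n (label u) (label v)) then 1ℝ else 0ℝ

{-# OPTIONS --safe #-}

-- Every vertex u other than the centre has a single out-neighbour, so a walk from u is forced
-- until it reaches the centre after k ≤ n - 1 steps; hence row u of M^(k + l) is the row of
-- the centre in M^l.  The centre has m out-neighbours, each at distance n - 1 from it, so its
-- rows satisfy M^(n + l) = m M^l.  Together: M^(n + l) = m M^l as soon as n - 1 ≤ l, which
-- gives (1) and (5).  For (3) and (4): on the left-hand side, the rows of the first vertices of
-- two different blades coincide, on the right-hand side they do not.  For (2): the first vertex
-- of a blade reaches the centre in exactly n - 1 steps.
module Submission where

open import Defs using (module SquareMatrix; Edge; order; label)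
open import Algebra.Bundles using (CommutativeRing; Semiring)
open import Data.Bool.Base using (if_then_else_)
open import Data.Fin.Base as Fin using (Fin; toℕ; fromℕ<)
import Data.Fin.Properties as Fin
open import Data.Nat.Base using (ℕ; zero; suc; _+_; _≤_; _<_; _*_; _∸_; _^_; z≤n; s≤s; z<s; s<s; NonZero)
open import Data.Nat.Divisibility using (divides; ∣m+n∣m⇒∣n; >⇒∤; n∣m*n)
open import Data.Nat.DivMod using (_/_; _%_; m≡m%n+[m/n]*n; m%n<n; m<n*o⇒m/o<n)
import Data.Nat.Properties as ℕ
open import Data.Product.Base using (_×_; _,_; ∃-syntax)
open import Data.Rational.Base as ℚ using (0ℚ; 1ℚ)
import Data.Rational.Properties as ℚ
open import Data.Sum.Base using (inj₁; inj₂)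
open import Function.Base using (_∘_)
open import Relation.Binary.PropositionalEquality as ≡ using (_≡_; _≢_; cong; cong₂; subst; subst₂)
open import Relation.Nullary.Decidable using (Dec; yes; no; does)
open import Relation.Nullary.Negation.Core using (¬_; contradiction)

-- Otherwise `p` would divide `s`, although `0 < s < p`. This tells apart the labels of the centre's
-- out-neighbours, of the blade tips and of the remaining blade vertices.
strictly-between-multiples : ∀ p j k s .{{_ : NonZero s}} → s < p → j * p + s ≢ k * p
strictly-between-multiples p j k s s<p eq =
  >⇒∤ s<p (∣m+n∣m⇒∣n (divides k eq) (n∣m*n j))

-- The walk argument uses only semiring laws; properties of the reals enter later, through `1 ≉ 0`
-- and `m ≉ 0`.
module _ {c ℓ} (R : Semiring c ℓ) where

  open Semiring R hiding (zero) renaming (Carrier to A; _+_ to _+ᴿ_; _*_ to _*ᴿ_)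
  open SquareMatrix R
  open import Algebra.Properties.Semiring.Sum R using (sum; sum-cong-≋; sum-replicate-zero; *-distribʳ-sum)
  open import Algebra.Properties.Semiring.Mult R using (×1-homo-*)
  open import Relation.Binary.Reasoning.Setoid setoid

  -- Finite sums over a semiring.

  sum-zero : ∀ {d} (f : Fin d → A) → (∀ x → f x ≈ 0#) → sum f ≈ 0#
  sum-zero {d} f f≈0 = trans (sum-cong-≋ f≈0) (sum-replicate-zero d)

  sum-single : ∀ {d} (f : Fin d → A) s → (∀ x → x ≢ s → f x ≈ 0#) → sum f ≈ f s
  sum-single f Fin.zero    f≈0 = trans
    (+-congˡ (sum-zero (f ∘ Fin.suc) λ x → f≈0 (Fin.suc x) λ ())) (+-identityʳ (f Fin.zero))
  sum-single f (Fin.suc s) f≈0 = trans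
    (+-cong (f≈0 Fin.zero λ ()) (sum-single (f ∘ Fin.suc) s λ x x≢s → f≈0 (Fin.suc x) (x≢s ∘ Fin.suc-injective)))
    (+-identityˡ (f (Fin.suc s)))

  sumTo : ℕ → (ℕ → A) → A
  sumTo d h = sum {d} (h ∘ toℕ)

  sumTo-+ : ∀ a b h → sumTo (a + b) h ≈ sumTo a h +ᴿ sumTo b (h ∘ (a +_))
  sumTo-+ zero    b h = sym (+-identityˡ _)
  sumTo-+ (suc a) b h = trans (+-congˡ (sumTo-+ a b (h ∘ suc))) (sym (+-assoc _ _ _))

  -- Peeling off the first block of `p` summands leaves the same situation for `h` shifted by `p`.
  -- Applied to the centre's row, this counts the blades.
  sumTo-multiples : ∀ q k (h : ℕ → A) → let p : ℕ; p = suc q in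
    (∀ j → j < k → h (j * p) ≈ 1#) →
    (∀ j r → j < k → r < q → h (j * p + suc r) ≈ 0#) →
    sumTo (k * p) h ≈ fromℕ k
  sumTo-multiples q zero    h one nil = refl
  sumTo-multiples q (suc k) h one nil = begin
    sumTo (p + k * p) h                     ≈⟨ sumTo-+ p (k * p) h ⟩
    sumTo p h +ᴿ sumTo (k * p) (h ∘ (p +_)) ≈⟨ +-cong block rest ⟩
    1# +ᴿ fromℕ k                           ∎
    where
    p : ℕ
    p = suc q
    block : sumTo p h ≈ 1#
    block = trans
      (+-cong (one 0 z<s) (sum-zero {q} (h ∘ suc ∘ toℕ) λ x → nil 0 (toℕ x) z<s (Fin.toℕ<n x)))
      (+-identityʳ 1#)
    rest : sumTo (k * p) (h ∘ (p +_)) ≈ fromℕ k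
    rest = sumTo-multiples q k (h ∘ (p +_))
      (λ j j<k → one (suc j) (s<s j<k))
      (λ j r j<k r<q → subst (λ y → h y ≈ 0#) (ℕ.+-assoc p (j * p) (suc r)) (nil (suc j) r (s<s j<k) r<q))

  -- The blades have p = 1 + q vertices besides the centre, so the cycles have length n = 1 + p.
  -- Vertex r of blade j, both counted from 0, has label j p + r + 2.
  module Windmill (m q : ℕ) (edge? : ∀ a b → Dec (Edge m (2 + q) a b)) (M : Matrix (order m (2 + q)))
    (M≈indicator : ∀ u v → M u v ≈ (if does (edge? (label u) (label v)) then 1# else 0#)) where

    p n : ℕ
    p = suc q
    n = suc p

    Vertex : Set
    Vertex = Fin (order m n)

    -- Edges and out-neighbours.

    entry : ℕ → ℕ → A
    entry a b = if does (edge? a b) then 1# else 0#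

    _⟶_ : Vertex → Vertex → Set
    u ⟶ v = Edge m n (label u) (label v)

    entry-edge : ∀ {a b} → Edge m n a b → entry a b ≈ 1#
    entry-edge {a} {b} e with edge? a b
    ... | yes _ = refl
    ... | no ¬e = contradiction e ¬e

    entry-¬edge : ∀ {a b} → ¬ Edge m n a b → entry a b ≈ 0#
    entry-¬edge {a} {b} ¬e with edge? a b
    ... | yes e = contradiction e ¬e
    ... | no _  = refl

    M-edge : ∀ {u v} → u ⟶ v → M u v ≈ 1#
    M-edge u⟶v = trans (M≈indicator _ _) (entry-edge u⟶v)

    M-¬edge : ∀ {u v} → ¬ u ⟶ v → M u v ≈ 0#
    M-¬edge ¬u⟶v = trans (M≈indicator _ _) (entry-¬edge ¬u⟶v)

    edge-from-1 : ∀ {b} → Edge m n 1 b → ∃[ j ] (j < m × b ≡ j * p + 2)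
    edge-from-1 (inj₁ (suc j , (_ , j<m) , _ , b≡)) = j , j<m , b≡
    edge-from-1 (inj₂ (inj₁ (suc k , _ , suc (suc i) , _ , 1≡ , _))) =
      contradiction (subst (2 ≤_) (≡.sym 1≡) (ℕ.m≤n⇒m≤o+n (k * p) (s≤s (s≤s z≤n)))) λ { (s≤s ()) }
    edge-from-1 (inj₂ (inj₁ (suc k , _ , suc zero , (s≤s () , _) , _)))
    edge-from-1 (inj₂ (inj₂ (suc k , _ , 1≡ , _))) =
      contradiction (subst (2 ≤_) (≡.sym 1≡) (ℕ.m≤n⇒m≤o+n (k * p) (s≤s (s≤s z≤n)))) λ { (s≤s ()) }

    -- An edge back to the centre starts at a label one above a multiple of `p`; here the label
    -- minus one lies `r + 1` above such a multiple, with `0 < r + 1 < p`.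
    edge-inside : ∀ {j r b} → r < q → Edge m n (j * p + r + 2) b → b ≡ j * p + r + 3
    edge-inside {j} {r} r<q (inj₁ (_ , _ , a≡1 , _)) =
      contradiction (≡.trans (≡.sym a≡1) (ℕ.+-comm (j * p + r) 2)) λ ()
    -- Every edge of this kind raises the label by one, whichever blade and index present it.
    edge-inside {j} {r} r<q (inj₂ (inj₁ (_ , _ , _ , _ , a≡ , b≡))) =
      ≡.trans b≡ (≡.trans (cong (_+ 1) (≡.sym a≡)) (ℕ.+-assoc (j * p + r) 2 1))
    edge-inside {j} {r} r<q (inj₂ (inj₂ (suc k , _ , a≡ , _))) =
      contradiction (ℕ.suc-injective (≡.trans lhs (≡.trans a≡ rhs)))
        (strictly-between-multiples p j (suc k) (suc r) (s<s r<q))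
      where
      lhs : suc (j * p + suc r) ≡ j * p + r + 2
      lhs = ≡.trans (cong suc (ℕ.+-suc (j * p) r)) (ℕ.+-comm 2 (j * p + r))
      rhs : k * p + suc p ≡ suc (suc k * p)
      rhs = ≡.trans (ℕ.+-suc (k * p) p) (cong suc (ℕ.+-comm (k * p) p))

    -- The tip's label is `suc j * p + 1`. An edge along a blade starts at a label which, minus one,
    -- lies strictly between two multiples of `p`.
    edge-tip : ∀ {j b} → Edge m n (j * p + q + 2) b → b ≡ 1
    edge-tip {j} (inj₁ (_ , _ , a≡1 , _)) =
      contradiction (≡.trans (≡.sym a≡1) (ℕ.+-comm (j * p + q) 2)) λ ()
    edge-tip {j} (inj₂ (inj₁ (suc k , _ , suc (suc i) , (_ , s≤s i<q) , a≡ , _))) =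
      contradiction (ℕ.suc-injective (≡.trans (≡.sym (ℕ.+-suc (k * p) (suc i))) (≡.trans (≡.sym a≡) lhs)))
        (strictly-between-multiples p k (suc j) (suc i) (s≤s i<q))
      where
      lhs : j * p + q + 2 ≡ suc (suc j * p)
      lhs = ≡.trans (ℕ.+-comm (j * p + q) 2) (cong (suc ∘ suc) (ℕ.+-comm (j * p) q))
    edge-tip {j} (inj₂ (inj₁ (suc k , _ , suc zero , (s≤s () , _) , _)))
    edge-tip (inj₂ (inj₂ (_ , _ , _ , b≡1))) = b≡1

    -- Vertices in blade coordinates.

    centre : Vertex
    centre = fromℕ< (ℕ.m≤n+m 1 (m * p))

    label-centre : label centre ≡ 1
    label-centre = cong suc (Fin.toℕ-fromℕ< _)

    blade< : ∀ {j r} → j < m → r < p → suc (j * p + r) < order m n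
    blade< {j} {r} j<m r<p = subst (suc (suc (j * p + r)) ≤_) (ℕ.+-comm 1 (m * p))
      (s≤s (ℕ.≤-trans (ℕ.+-monoʳ-< (j * p) r<p)
        (ℕ.≤-trans (ℕ.≤-reflexive (ℕ.+-comm (j * p) p)) (ℕ.*-monoˡ-≤ p j<m))))

    blade : ∀ {j r} → j < m → r < p → Vertex
    blade j<m r<p = fromℕ< (blade< j<m r<p)

    label-blade : ∀ {j r} (j<m : j < m) (r<p : r < p) → label (blade j<m r<p) ≡ j * p + r + 2
    label-blade {j} {r} j<m r<p = ≡.trans (cong suc (Fin.toℕ-fromℕ< _)) (ℕ.+-comm 2 (j * p + r))

    label-injective : ∀ {u v : Vertex} → label u ≡ label v → u ≡ v
    label-injective = Fin.toℕ-injective ∘ ℕ.suc-injective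

    -- Forced walks and rows of powers.

    -- Uniqueness of the successor is demanded at every vertex that is left, but not at the end `t`,
    -- so that `t` may be the centre.
    data ForcedWalk (t : Vertex) : ℕ → Vertex → Set where
      done : ForcedWalk t 0 t
      step : ∀ {k u s} → u ⟶ s → (∀ {x} → u ⟶ x → x ≡ s) → ForcedWalk t k s → ForcedWalk t (suc k) u

    -- At each vertex that is left, the row of `M` has a single nonzero entry, equal to `1`;
    -- multiplying by `M` therefore copies the row of the next vertex.
    forced-row : ∀ {t k u} → ForcedWalk t k u → ∀ l v → (M ^ᴹ (k + l)) u v ≈ (M ^ᴹ l) t v
    forced-row done l v = refl
    forced-row {t} {suc k} {u} (step {s = s} u⟶s unique walk) l v = begin
      sum (λ x → M u x *ᴿ (M ^ᴹ (k + l)) x v)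
        ≈⟨ sum-single _ s (λ x x≢s → trans (*-congʳ (M-¬edge (x≢s ∘ unique))) (zeroˡ _)) ⟩
      M u s *ᴿ (M ^ᴹ (k + l)) s v ≈⟨ *-congʳ (M-edge u⟶s) ⟩
      1# *ᴿ (M ^ᴹ (k + l)) s v    ≈⟨ *-identityˡ _ ⟩
      (M ^ᴹ (k + l)) s v          ≈⟨ forced-row walk l v ⟩
      (M ^ᴹ l) t v                ∎

    forced-snoc : ∀ {t t′ k u} → ForcedWalk t k u → t ⟶ t′ → (∀ {x} → t ⟶ x → x ≡ t′) →
                  ForcedWalk t′ (suc k) u
    forced-snoc done                  e! unique = step e! unique done
    forced-snoc (step e unique′ walk) e! unique = step e unique′ (forced-snoc walk e! unique)

    blade⟶next : ∀ {j r} (j<m : j < m) (r<q : r < q) → blade j<m (ℕ.m≤n⇒m≤1+n r<q) ⟶ blade j<m (s<s r<q)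
    -- `Edge` counts blades from 1 and positions from 2, whereas `j` and `r` count from 0.
    blade⟶next {j} {r} j<m r<q = inj₂ (inj₁ (suc j , (s≤s z≤n , j<m) , r + 2
      , (ℕ.m≤n+m 2 r , subst (_≤ p) (ℕ.+-comm 2 r) (s≤s r<q))
      , ≡.trans (label-blade j<m (ℕ.m≤n⇒m≤1+n r<q)) (ℕ.+-assoc (j * p) r 2)
      , ≡.trans (label-blade j<m (s<s r<q)) next))
      where
      next : j * p + suc r + 2 ≡ j * p + (r + 2) + 1
      next = ≡.trans (cong (_+ 2) (ℕ.+-suc (j * p) r)) (≡.trans (ℕ.+-comm _ 2)
        (≡.trans (ℕ.+-comm 3 (j * p + r)) (≡.trans (≡.sym (ℕ.+-assoc (j * p + r) 2 1))
          (cong (_+ 1) (ℕ.+-assoc (j * p) r 2)))))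

    tip⟶centre : ∀ {j} (j<m : j < m) → blade j<m (ℕ.n<1+n q) ⟶ centre
    tip⟶centre {j} j<m = inj₂ (inj₂ (suc j , (s≤s z≤n , j<m)
      , ≡.trans (label-blade j<m (ℕ.n<1+n q)) (≡.trans (ℕ.+-assoc (j * p) q 2) (cong (j * p +_) (ℕ.+-comm q 2)))
      , label-centre))

    -- Stopping at the tip matters for (3): walks of length `n - 2` down different blades have
    -- different ends, while one step later they meet at the centre.
    forced-to-tip : ∀ {j} (j<m : j < m) k r (r<p : r < p) → k + r ≡ q →
                    ForcedWalk (blade j<m (ℕ.n<1+n q)) k (blade j<m r<p)
    forced-to-tip j<m zero r r<p ≡.refl = done
    forced-to-tip {j} j<m (suc k) r r<p eq =
      step (blade⟶next j<m r<q)
        (λ {x} e → label-injective (≡.trans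
          (edge-inside {j} r<q (subst (λ a → Edge m n a (label x)) (label-blade j<m r<p) e))
          (≡.sym (≡.trans (label-blade j<m (s<s r<q)) next))))
        (forced-to-tip j<m k (suc r) (s<s r<q) (≡.trans (ℕ.+-suc k r) eq))
      where
      r<q : r < q
      r<q = subst (r <_) eq (s≤s (ℕ.m≤n+m r k))
      next : j * p + suc r + 2 ≡ j * p + r + 3
      next = ≡.trans (cong (_+ 2) (ℕ.+-suc (j * p) r)) (≡.sym (ℕ.+-suc (j * p + r) 2))

    forced-to-centre : ∀ {j} (j<m : j < m) k r (r<p : r < p) → k + r ≡ q →
                       ForcedWalk centre (suc k) (blade j<m r<p)
    forced-to-centre {j} j<m k r r<p eq = forced-snoc (forced-to-tip j<m k r r<p eq) (tip⟶centre j<m)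
      λ {x} e → label-injective (≡.trans
        (edge-tip {j} (subst (λ a → Edge m n a (label x)) (label-blade j<m (ℕ.n<1+n q)) e)) (≡.sym label-centre))

    forced : ∀ u → ∃[ k ] (k ≤ p × ForcedWalk centre k u)
    forced u with toℕ u in eq
    ... | zero  = 0 , z≤n
        , subst (ForcedWalk centre 0) (label-injective (≡.trans label-centre (cong suc (≡.sym eq)))) done
    ... | suc y = suc (q ∸ r) , s≤s (ℕ.m∸n≤m q r)
        , subst (ForcedWalk centre _) (label-injective same)
            (forced-to-centre j<m (q ∸ r) r r<p (ℕ.m∸n+n≡m (ℕ.≤-pred r<p)))
      where
      -- The label of `u` is `y + 2` and that of a blade vertex is `j * p + r + 2`, so dividing `y`
      -- by `p` recovers the coordinates.
      j = y / p
      r = y % p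
      y<mp : y < m * p
      y<mp = ℕ.≤-pred (subst₂ _<_ eq (ℕ.+-comm (m * p) 1) (Fin.toℕ<n u))
      j<m : j < m
      j<m = m<n*o⇒m/o<n y<mp
      r<p : r < p
      r<p = m%n<n y p
      same : label (blade j<m r<p) ≡ label u
      same = ≡.trans (label-blade j<m r<p) (≡.trans (ℕ.+-comm (j * p + r) 2)
        (cong suc (≡.trans (cong suc (≡.trans (ℕ.+-comm (j * p) r) (≡.sym (m≡m%n+[m/n]*n y p)))) (≡.sym eq))))

    -- The centre's row and the recurrence.

    out-degree-centre : sum (M centre) ≈ fromℕ m
    out-degree-centre = begin
      sum (M centre)                          ≈⟨ sum-cong-≋ (M≈indicator centre) ⟩
      sumTo (order m n) (entry (label centre) ∘ suc)
        ≡⟨ cong (λ a → sumTo (order m n) (entry a ∘ suc)) label-centre ⟩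
      -- Commuting the length to `1 + m * p` splits off the centre's own column; the rest falls into
      -- `m` blocks of `p` columns.
      sumTo (m * p + 1) (entry 1 ∘ suc)       ≡⟨ cong (λ d → sumTo d (entry 1 ∘ suc)) (ℕ.+-comm (m * p) 1) ⟩
      entry 1 1 +ᴿ sumTo (m * p) (entry 1 ∘ suc ∘ suc)
        ≈⟨ +-cong (entry-¬edge no-loop) (sumTo-multiples q m (entry 1 ∘ suc ∘ suc) first other) ⟩
      0# +ᴿ fromℕ m                           ≈⟨ +-identityˡ _ ⟩
      fromℕ m                                 ∎
      where
      no-loop : ¬ Edge m n 1 1
      no-loop e with edge-from-1 e
      ... | j , _ , 1≡ = contradiction (≡.trans 1≡ (ℕ.+-comm (j * p) 2)) λ ()
      first : ∀ j → j < m → entry 1 (suc (suc (j * p))) ≈ 1#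
      first j j<m = entry-edge (inj₁ (suc j , (s≤s z≤n , j<m) , ≡.refl , ℕ.+-comm 2 (j * p)))
      other : ∀ j r → j < m → r < q → entry 1 (suc (suc (j * p + suc r))) ≈ 0#
      other j r j<m r<q = entry-¬edge λ e → let k , _ , eq = edge-from-1 e in
        strictly-between-multiples p j k (suc r) (s<s r<q)
          (ℕ.suc-injective (ℕ.suc-injective (≡.trans eq (ℕ.+-comm (k * p) 2))))

    -- Each out-neighbour of the centre returns to it by a forced walk of length `p`, so the sum has
    -- a common factor, the centre's row of `M ^ᴹ l`, and what remains is the out-degree.
    centre-recurrence : ∀ l v → (M ^ᴹ (n + l)) centre v ≈ fromℕ m *ᴿ (M ^ᴹ l) centre v
    centre-recurrence l v = begin
      sum (λ x → M centre x *ᴿ (M ^ᴹ (p + l)) x v) ≈⟨ sum-cong-≋ same-row ⟩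
      sum (λ x → M centre x *ᴿ (M ^ᴹ l) centre v)  ≈⟨ *-distribʳ-sum _ (M centre) ⟨
      sum (M centre) *ᴿ (M ^ᴹ l) centre v          ≈⟨ *-congʳ out-degree-centre ⟩
      fromℕ m *ᴿ (M ^ᴹ l) centre v                 ∎
      where
      same-row : ∀ x → M centre x *ᴿ (M ^ᴹ (p + l)) x v ≈ M centre x *ᴿ (M ^ᴹ l) centre v
      same-row x with edge? (label centre) (label x)
      ... | no ¬e = trans (vanish ¬e) (sym (vanish ¬e))
        where
        vanish : ¬ centre ⟶ x → ∀ {y} → M centre x *ᴿ y ≈ 0#
        vanish ¬e = trans (*-congʳ (M-¬edge ¬e)) (zeroˡ _)
      ... | yes e with edge-from-1 (subst (λ a → Edge m n a (label x)) label-centre e)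
      ...   | j , j<m , x≡ = *-congˡ (forced-row walk l v)
        where
        walk : ForcedWalk centre p x
        walk = subst (ForcedWalk centre p)
          (label-injective (≡.trans (label-blade j<m z<s) (≡.trans (cong (_+ 2) (ℕ.+-identityʳ (j * p))) (≡.sym x≡))))
          (forced-to-centre j<m q 0 z<s (ℕ.+-identityʳ q))

    -- The forced walk from `u` is used twice: towards the centre on the left and back to `u` on the
    -- right. The bound `p ≤ l` leaves room for its `k` steps in `M ^ᴹ l`.
    recurrence : ∀ {l} → p ≤ l → M ^ᴹ (n + l) ≈ᴹ fromℕ m ·ᴹ M ^ᴹ l
    recurrence {l} p≤l u v with forced u
    ... | k , k≤p , walk = begin
      (M ^ᴹ (n + l)) u v                ≡⟨ cong (λ a → (M ^ᴹ a) u v) n+l≡ ⟩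
      (M ^ᴹ (k + (n + e))) u v          ≈⟨ forced-row walk (n + e) v ⟩
      (M ^ᴹ (n + e)) centre v           ≈⟨ centre-recurrence e v ⟩
      fromℕ m *ᴿ (M ^ᴹ e) centre v      ≈⟨ *-congˡ (forced-row walk e v) ⟨
      fromℕ m *ᴿ (M ^ᴹ (k + e)) u v     ≡⟨ cong (λ a → fromℕ m *ᴿ (M ^ᴹ a) u v) k+e≡l ⟩
      fromℕ m *ᴿ (M ^ᴹ l) u v           ∎
      where
      e = l ∸ k
      k+e≡l : k + e ≡ l
      k+e≡l = ℕ.m+[n∸m]≡n (ℕ.≤-trans k≤p p≤l)
      n+l≡ : n + l ≡ k + (n + e)
      n+l≡ = ≡.trans (cong (n +_) (≡.sym k+e≡l)) (≡.trans (≡.sym (ℕ.+-assoc n k e))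
        (≡.trans (cong (_+ e) (ℕ.+-comm n k)) (ℕ.+-assoc k n e)))

    -- The exponent `p` is the smallest covered by `recurrence`, and adding multiples of `n` stays
    -- in range. Taking `i = p` gives (5), since `p * n + p` is `n ^ 2 - 1`.
    iterated-recurrence : ∀ i → M ^ᴹ (i * n + p) ≈ᴹ fromℕ (m ^ i) ·ᴹ M ^ᴹ p
    -- `fromℕ 1` unfolds to `1# + 0#`, not to `1#`.
    iterated-recurrence zero    u v = sym (trans (*-congʳ (+-identityʳ 1#)) (*-identityˡ _))
    iterated-recurrence (suc i) u v = begin
      (M ^ᴹ (n + i * n + p)) u v                        ≡⟨ cong (λ a → (M ^ᴹ a) u v) (ℕ.+-assoc n (i * n) p) ⟩
      (M ^ᴹ (n + (i * n + p))) u v                      ≈⟨ recurrence (ℕ.m≤n+m p (i * n)) u v ⟩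
      fromℕ m *ᴿ (M ^ᴹ (i * n + p)) u v                 ≈⟨ *-congˡ (iterated-recurrence i u v) ⟩
      fromℕ m *ᴿ (fromℕ (m ^ i) *ᴿ (M ^ᴹ p) u v)        ≈⟨ *-assoc _ _ _ ⟨
      fromℕ m *ᴿ fromℕ (m ^ i) *ᴿ (M ^ᴹ p) u v          ≈⟨ *-congʳ (×1-homo-* m (m ^ i)) ⟨
      fromℕ (m * m ^ i) *ᴿ (M ^ᴹ p) u v                 ∎

    -- Entries that refute equalities.

    Iᴹ-diagonal : ∀ (u : Vertex) → Iᴹ u u ≈ 1#
    Iᴹ-diagonal u with u Fin.≟ u
    ... | yes _  = refl
    ... | no u≢u = contradiction ≡.refl u≢u

    Iᴹ-offDiagonal : ∀ {u v : Vertex} → u ≢ v → Iᴹ u v ≈ 0#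
    Iᴹ-offDiagonal {u} {v} u≢v with u Fin.≟ v
    ... | yes u≡v = contradiction u≡v u≢v
    ... | no _    = refl

    forced-entry : ∀ {t k u} → ForcedWalk t k u → ∀ v → (M ^ᴹ k) u v ≈ Iᴹ t v
    forced-entry {k = k} {u} walk v = trans
      (reflexive (cong (λ a → (M ^ᴹ a) u v) (≡.sym (ℕ.+-identityʳ k)))) (forced-row walk 0 v)

    power-p≉0 : ¬ (1# ≈ 0#) → 0 < m → ¬ (M ^ᴹ p ≈ᴹ 0ᴹ)
    power-p≉0 1≉0 0<m M≈0 = 1≉0 (begin
      1#                                 ≈⟨ Iᴹ-diagonal centre ⟨
      Iᴹ centre centre                   ≈⟨ forced-entry (forced-to-centre 0<m q 0 z<s (ℕ.+-identityʳ q)) centre ⟨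
      (M ^ᴹ p) (blade 0<m z<s) centre    ≈⟨ M≈0 (blade 0<m z<s) centre ⟩
      0#                                 ∎)

    -- Column `t` is compared in rows `u` and `u′`. On the left both entries equal that of the
    -- centre in `M ^ᴹ l`; on the right they are `fromℕ m` and zero.
    distinct-ends⇒≉ : ∀ {k l u u′ t t′} → ¬ (fromℕ m ≈ 0#) → ForcedWalk centre p u → ForcedWalk centre p u′ →
      ForcedWalk t k u → ForcedWalk t′ k u′ → t′ ≢ t → ¬ (M ^ᴹ (p + l) ≈ᴹ fromℕ m ·ᴹ M ^ᴹ k)
    distinct-ends⇒≉ {k} {l} {u} {u′} {t} {t′} m≉0 centre-u centre-u′ walk walk′ t′≢t M≈ =
      m≉0 (begin
        fromℕ m                          ≈⟨ *-identityʳ _ ⟨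
        fromℕ m *ᴿ 1#                    ≈⟨ *-congˡ (trans (forced-entry walk t) (Iᴹ-diagonal t)) ⟨
        fromℕ m *ᴿ (M ^ᴹ k) u t          ≈⟨ M≈ u t ⟨
        (M ^ᴹ (p + l)) u t               ≈⟨ forced-row centre-u l t ⟩
        (M ^ᴹ l) centre t                ≈⟨ forced-row centre-u′ l t ⟨
        (M ^ᴹ (p + l)) u′ t              ≈⟨ M≈ u′ t ⟩
        fromℕ m *ᴿ (M ^ᴹ k) u′ t         ≈⟨ *-congˡ (trans (forced-entry walk′ t) (Iᴹ-offDiagonal t′≢t)) ⟩
        fromℕ m *ᴿ 0#                    ≈⟨ zeroʳ _ ⟩
        0#                               ∎)

    blade-distinct : ∀ {r} (0<m : 0 < m) (1<m : 1 < m) (r<p : r < p) → blade 1<m r<p ≢ blade 0<m r<p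
    blade-distinct {r} 0<m 1<m r<p eq = contradiction
      (ℕ.+-cancelʳ-≡ r (1 * p) 0 (ℕ.+-cancelʳ-≡ 2 (1 * p + r) r
        (≡.trans (≡.sym (label-blade 1<m r<p)) (≡.trans (cong label eq) (label-blade 0<m r<p))))) λ ()

  -- The five claims over a semiring.

  windmill-powers : ∀ m n (edge? : ∀ a b → Dec (Edge m n a b)) (M : Matrix (order m n)) →
    (∀ u v → M u v ≈ (if does (edge? (label u) (label v)) then 1# else 0#)) →
    ¬ (1# ≈ 0#) → ¬ (fromℕ m ≈ 0#) → 2 ≤ m → 3 ≤ n →
      (M ^ᴹ (2 * n ∸ 1) ≈ᴹ fromℕ m ·ᴹ M ^ᴹ (n ∸ 1))
    × (¬ (M ^ᴹ (n ∸ 1) ≈ᴹ 0ᴹ))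
    × (¬ (M ^ᴹ (2 * n ∸ 2) ≈ᴹ fromℕ m ·ᴹ M ^ᴹ (n ∸ 2)))
    × (¬ (M ^ᴹ n ≈ᴹ fromℕ m ·ᴹ Iᴹ))
    × (M ^ᴹ (n ^ 2 ∸ 1) ≈ᴹ fromℕ (m ^ (n ∸ 1)) ·ᴹ M ^ᴹ (n ∸ 1))
  windmill-powers m (suc (suc q)) edge? M M≈indicator 1≉0 m≉0 1<m (s≤s (s≤s _)) =
      subst (λ a → M ^ᴹ a ≈ᴹ fromℕ m ·ᴹ M ^ᴹ p) exponent₁ (recurrence ℕ.≤-refl)
    , power-p≉0 1≉0 0<m
    , subst (λ a → ¬ (M ^ᴹ a ≈ᴹ fromℕ m ·ᴹ M ^ᴹ q)) exponent₃
        -- Here `k = q` and `l = p`; the distinct ends are the tips of blades 0 and 1.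
        (distinct-ends⇒≉ m≉0 (to-centre 0<m) (to-centre 1<m) (to-tip 0<m) (to-tip 1<m)
          (blade-distinct 0<m 1<m (ℕ.n<1+n q)))
    , subst (λ a → ¬ (M ^ᴹ a ≈ᴹ fromℕ m ·ᴹ Iᴹ)) (ℕ.+-comm p 1)
        -- Here `k = 0` and `l = 1`: the walks are empty, and `M ^ᴹ 0` is `Iᴹ` by definition.
        (distinct-ends⇒≉ m≉0 (to-centre 0<m) (to-centre 1<m) done done (blade-distinct 0<m 1<m z<s))
    , subst (λ a → M ^ᴹ a ≈ᴹ fromℕ (m ^ p) ·ᴹ M ^ᴹ p) exponent₅ (iterated-recurrence p)
    where
    open Windmill m q edge? M M≈indicator
    0<m : 0 < m
    0<m = ℕ.<-trans z<s 1<m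
    to-centre : ∀ {j} (j<m : j < m) → ForcedWalk centre p (blade j<m z<s)
    to-centre j<m = forced-to-centre j<m q 0 z<s (ℕ.+-identityʳ q)
    to-tip : ∀ {j} (j<m : j < m) → ForcedWalk (blade j<m (ℕ.n<1+n q)) q (blade j<m z<s)
    to-tip j<m = forced-to-tip j<m q 0 z<s (ℕ.+-identityʳ q)
    exponent₁ : n + p ≡ 2 * n ∸ 1
    exponent₁ = ≡.trans (≡.sym (ℕ.+-suc p p)) (cong (λ a → p + suc a) (≡.sym (ℕ.+-identityʳ p)))
    exponent₃ : p + p ≡ 2 * n ∸ 2
    exponent₃ = ≡.trans (≡.sym (ℕ.+-suc q p)) (cong (λ a → q + suc a) (≡.sym (ℕ.+-identityʳ p)))
    exponent₅ : p * n + p ≡ n ^ 2 ∸ 1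
    exponent₅ = ≡.trans (ℕ.+-comm (p * n) p)
      (cong₂ _+_ (≡.sym (ℕ.*-identityʳ p)) (cong (p *_) (≡.sym (ℕ.*-identityʳ n))))

-- Specialisation to the real numbers.

open import Defs

module ℝR = CommutativeRing ℝ-commutativeRing

fromℕ-nonNeg : ∀ k i → 0ℚ ℚ.≤ seq (fromℕ k) i
fromℕ-nonNeg zero    i = ℚ.≤-refl
fromℕ-nonNeg (suc k) i = ℚ.+-mono-≤ (ℚ.nonNegative⁻¹ 1ℚ) (fromℕ-nonNeg k i)

1≤p⇒1≤∣p-0∣ : ∀ p → 1ℚ ℚ.≤ p → 1ℚ ℚ.≤ ℚ.∣ p ℚ.- 0ℚ ∣
1≤p⇒1≤∣p-0∣ p 1≤p = subst (λ x → 1ℚ ℚ.≤ ℚ.∣ x ∣) (≡.sym (ℚ.+-identityʳ p))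
  (subst (1ℚ ℚ.≤_) (≡.sym (ℚ.0≤p⇒∣p∣≡p (ℚ.≤-trans (ℚ.nonNegative⁻¹ 1ℚ) 1≤p))) 1≤p)

-- Equality with zero at tolerance `1` would force some term to have absolute value below `1`.
1≤seq⇒≉0 : ∀ x → (∀ i → 1ℚ ℚ.≤ seq x i) → ¬ (x ≈ℝ 0ℝ)
1≤seq⇒≉0 x 1≤x (mk≈ e) with e 1ℚ (ℚ.positive⁻¹ 1ℚ)
... | N , close = ℚ.<-irrefl ≡.refl (ℚ.≤-<-trans (1≤p⇒1≤∣p-0∣ (seq x N) (1≤x N)) (close N ℕ.≤-refl))

fromℕ≉0 : ∀ {k} → 0 < k → ¬ (fromℕ k ≈ℝ 0ℝ)
fromℕ≉0 (s≤s {n = k} z≤n) = 1≤seq⇒≉0 (fromℕ (suc k)) λ i → ℚ.+-monoʳ-≤ 1ℚ (fromℕ-nonNeg k i)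

1≉0 : ¬ (1ℝ ≈ℝ 0ℝ)
1≉0 = 1≤seq⇒≉0 1ℝ λ _ → ℚ.≤-refl

theorem3p1 : (m n : ℕ) → 2 ≤ m → 3 ≤ n →
    let M = adjacency m n in
    (M ^ᴹ (2 * n ∸ 1) ≈ᴹ fromℕ m ·ᴹ M ^ᴹ (n ∸ 1))
    × (¬ (M ^ᴹ (n ∸ 1) ≈ᴹ 0ᴹ))
    × (¬ (M ^ᴹ (2 * n ∸ 2) ≈ᴹ fromℕ m ·ᴹ M ^ᴹ (n ∸ 2)))
    × (¬ (M ^ᴹ n ≈ᴹ fromℕ m ·ᴹ Iᴹ))
    × (M ^ᴹ (n ^ 2 ∸ 1) ≈ᴹ fromℕ (m ^ (n ∸ 1)) ·ᴹ M ^ᴹ (n ∸ 1))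
-- Rewrapping with mk≈ and null restricts the conversion check to the sequences; without it the
-- Cauchy proofs inside the products are compared too, which does not finish in reasonable time.
theorem3p1 m n 1<m 2<n =
  let e₁ , e₂ , e₃ , e₄ , e₅ = windmill-powers ℝR.semiring m n (edge? m n) (adjacency m n)
        (λ u v → ℝR.refl {adjacency m n u v}) 1≉0 (fromℕ≉0 (ℕ.<-trans z<s 1<m)) 1<m 2<n
  in (λ u v → mk≈ (null (e₁ u v)))
   , (λ h → e₂ λ u v → mk≈ (null (h u v)))
   , (λ h → e₃ λ u v → mk≈ (null (h u v)))
   , (λ h → e₄ λ u v → mk≈ (null (h u v)))
   , (λ u v → mk≈ (null (e₅ u v)))
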